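{- Let $k\ge 2$ and $n\ge 1$ be integers and $x=\zeta_k$. Let $S=\mathrm{circ}(s_0,\dots,s_{k-1})\in\mathrm{BH}(k,k)$ be a circulant matrix, and for $0\le m\le k-1$ let $\lambda_m=\sum_{j=0}^{k-1}s_jx^{mj}$ be its eigenvalues. Suppose $H\in\mathrm{BH}(kn+k,k)$ has the block form \[H=\begin{pmatrix} S & F_k\otimes j_n\\ F_k^{\ast}\otimes j_n^{\top} & A\end{pmatrix},\] where $A=[A_{ij}]_{0\le i,j\le k-1}$ is a $kn\times kn$ matrix partitioned into $n\times n$ blocks $A_{ij}$. Then (1) for $i\neq j$, the entries of every row and of every column of $A_{ij}$ sum to $0$; (2) for each $0\le m\le k-1$, the entries of every row and of every column of $A_{mm}$ sum to $-\overline{\lambda_m}$.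
   Context: $\zeta_k=e^{2\pi\sqrt{ -1}/k}$. A complex Hadamard matrix of order $N$ is an $N\times N$ matrix $H$ with all entries of modulus $1$ and $HH^{\ast}=NI_N$, where $^{\ast}$ is conjugate transpose. $\mathrm{BH}(N,k)$ denotes the set of $N\times N$ complex Hadamard matrices with all entries $k$-th roots of unity. $\mathrm{circ}(s_0,\dots,s_{k-1})$ is the $k\times k$ matrix whose $(i,j)$ entry ($0\le i,j\le k-1$) is $s_{(j-i)\bmod k}$, i.e. first row $(s_0,\dots,s_{k-1})$ and each subsequent row the cyclic shift one place to the right of the previous. $F_k=[x^{(i-1)(j-1)}]_{1\le i,j\le k}$ is the Fourier matrix, $j_n$ is the all-ones row vector of length $n$, $j_n^\top$ its transpose, and $\otimes$ is the Kronecker product $A\otimes B=[a_{ij}B]$. -}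

module Defs where

open import Algebra.Apartness.Bundles using (HeytingField)
open import Algebra.Bundles.Raw using (RawRing)
import Algebra.Definitions.RawSemiring as RawSemiringDefinitions
open import Data.Bool.Base using (if_then_else_)
open import Data.Fin.Base using (Fin; toℕ; cast; combine; remQuot; splitAt)
open import Data.Fin.Properties using (nonZeroIndex; _≟_)
open import Data.Nat.Base as ℕ using (ℕ; zero; suc; NonZero)
open import Data.Nat.DivMod using (_mod_)
open import Data.Nat.Properties using (*-identityʳ)
open import Data.Product.Base using (∃-syntax; _×_; _,_; proj₁; proj₂)
open import Data.Sum.Base using (_⊎_; inj₂; [_,_]′)
open import Data.Vec.Functional using (Vector)
open import Function.Bundles using (_⇔_; Equivalence)
open import Level using (_⊔_) renaming (suc to lsuc)
open import Relation.Binary.Core using (Rel)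
open import Relation.Binary.PropositionalEquality.Core using (_≡_; sym)
open import Relation.Binary.Structures using (IsStrictPartialOrder)
open import Relation.Nullary.Decidable.Core using (⌊_⌋)
open import Relation.Nullary.Negation.Core using (¬_)

-- The field of real numbers, given axiomatically as an Archimedean,
-- Cauchy-complete ordered field; these axioms determine it up to isomorphism.
-- No decidability is assumed: strict order is primitive, and apartness means
-- comparability.

record RealField c ℓ₁ ℓ₂ : Set (lsuc (c ⊔ ℓ₁ ⊔ ℓ₂)) where
  field
    heytingField : HeytingField c ℓ₁ ℓ₂

  open HeytingField heytingField public

  rawRing : RawRing c ℓ₁
  rawRing = record
    { _≈_ = _≈_ ; _+_ = _+_ ; _*_ = _*_ ; -_ = -_ ; 0# = 0# ; 1# = 1# }

  open RawSemiringDefinitions (RawRing.rawSemiring rawRing) public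
    using () renaming (_×_ to _·_)

  infix 4 _<_ _≤_

  field
    _<_                  : Rel Carrier ℓ₂
    isStrictPartialOrder : IsStrictPartialOrder _≈_ _<_
    #⇔<⊎>                : ∀ {x y} → (x # y) ⇔ (x < y ⊎ y < x)
    0<1                  : 0# < 1#
    +-monoˡ-<            : ∀ {x y} z → x < y → x + z < y + z
    *-pos                : ∀ {x y} → 0# < x → 0# < y → 0# < x * y

  _≤_ : Rel Carrier ℓ₂
  x ≤ y = ¬ (y < x)

  IsCauchy : (ℕ → Carrier) → Set (c ⊔ ℓ₂)
  IsCauchy s = ∀ {ε} → 0# < ε →
    ∃[ N ] (∀ {m n} → N ℕ.≤ m → N ℕ.≤ n → s m < s n + ε)

  _ConvergesTo_ : (ℕ → Carrier) → Carrier → Set (c ⊔ ℓ₂)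
  s ConvergesTo l = ∀ {ε} → 0# < ε →
    ∃[ N ] (∀ {n} → N ℕ.≤ n → s n < l + ε × l < s n + ε)

  field
    archimedean : ∀ x → ∃[ n ] x < n · 1#
    complete    : ∀ s → IsCauchy s → ∃[ l ] s ConvergesTo l

  open IsStrictPartialOrder isStrictPartialOrder public
    using () renaming (trans to <-trans; <-respˡ-≈ to <-respˡ-≈; <-respʳ-≈ to <-respʳ-≈)

  0<1+n : ∀ n → 0# < suc n · 1#
  0<1+n zero    = <-respʳ-≈ (≈.sym (+-identityʳ 1#)) 0<1
    where module ≈ = HeytingField heytingField
  0<1+n (suc n) = <-trans (0<1+n n) (<-respˡ-≈ (+-identityˡ _) (+-monoˡ-< (suc n · 1#) 0<1))

  -- Invertibility of k comes from its apartness from 0, as inverse of k - 0.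
  1/_ : (k : ℕ) .{{_ : NonZero k}} → Carrier
  1/ (suc k) = proj₁ (#⇒invertible (Equivalence.from #⇔<⊎> (inj₂ (0<1+n k))))

module Complex {c ℓ₁ ℓ₂} (R : RealField c ℓ₁ ℓ₂) where

  private
    module ℝ = RealField R

  ℝ : Set c
  ℝ = ℝ.Carrier

  record ℂ : Set c where
    constructor _+i_
    field
      re im : ℝ

  open ℂ public

  infix  8 -_
  infixl 7 _*_
  infixl 6 _+_ _-_
  infix  4 _≈_

  _≈_ : Rel ℂ ℓ₁
  z ≈ w = (re z ℝ.≈ re w) × (im z ℝ.≈ im w)

  _+_ _*_ : ℂ → ℂ → ℂ
  z + w = (re z ℝ.+ re w) +i (im z ℝ.+ im w)
  z * w = (re z ℝ.* re w ℝ.- im z ℝ.* im w) +i (re z ℝ.* im w ℝ.+ im z ℝ.* re w)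

  -_ conj : ℂ → ℂ
  - z    = (ℝ.- re z) +i (ℝ.- im z)
  conj z = re z +i (ℝ.- im z)

  _-_ : ℂ → ℂ → ℂ
  z - w = z + (- w)

  0ℂ 1ℂ : ℂ
  0ℂ = ℝ.0# +i ℝ.0#
  1ℂ = ℝ.1# +i ℝ.0#

  ∣_∣² : ℂ → ℝ
  ∣ z ∣² = re z ℝ.* re z ℝ.+ im z ℝ.* im z

  rawRing : RawRing c ℓ₁
  rawRing = record
    { _≈_ = _≈_ ; _+_ = _+_ ; _*_ = _*_ ; -_ = -_ ; 0# = 0ℂ ; 1# = 1ℂ }

  open RawSemiringDefinitions (RawRing.rawSemiring rawRing) public
    using (_^_; sum) renaming (_×_ to _·_)

  -- exp is the unique homomorphism from (ℂ,+) to (ℂ,*) with derivative 1 at 0,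
  -- i.e. exp h - 1 - h = o(h).  Since ε and δ range over all positive reals,
  -- the estimate may be written with squared moduli.
  record IsExponential (exp : ℂ → ℂ) : Set (c ⊔ ℓ₁ ⊔ ℓ₂) where
    field
      cong         : ∀ {z w} → z ≈ w → exp z ≈ exp w
      homo         : ∀ z w → exp (z + w) ≈ exp z * exp w
      derivative-0 : ∀ {ε} → ℝ.0# ℝ.< ε →
                     ∃[ δ ] (ℝ.0# ℝ.< δ) ×
                     (∀ h → ∣ h ∣² ℝ.< δ → ∣ exp h - 1ℂ - h ∣² ℝ.≤ ε ℝ.* ∣ h ∣²)

  -- π is the first positive zero of sin t = Im e^{it}, before which sin is positive.
  record IsPi (exp : ℂ → ℂ) (π : ℝ) : Set (c ⊔ ℓ₁ ⊔ ℓ₂) where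
    sin : ℝ → ℝ
    sin t = im (exp (ℝ.0# +i t))
    field
      π>0   : ℝ.0# ℝ.< π
      sin-π : sin π ℝ.≈ ℝ.0#
      sin>0 : ∀ {t} → ℝ.0# ℝ.< t → t ℝ.< π → ℝ.0# ℝ.< sin t

  -- e^{2πi/k}
  ζ : (exp : ℂ → ℂ) (π : ℝ) (k : ℕ) .{{_ : NonZero k}} → ℂ
  ζ exp π k = exp (ℝ.0# +i ((2 ℝ.· π) ℝ.* (ℝ.1/ k)))

  Matrix : ℕ → ℕ → Set c
  Matrix m n = Fin m → Fin n → ℂ

  infix 4 _≋_
  _≋_ : ∀ {m n} → Rel (Matrix m n) ℓ₁
  A ≋ B = ∀ i j → A i j ≈ B i j

  infix 9 _ᵀ _ᴴ
  _ᵀ _ᴴ : ∀ {m n} → Matrix m n → Matrix n m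
  (A ᵀ) i j = A j i
  (A ᴴ) i j = conj (A j i)

  infixl 7 _⊡_ _⊗_
  _⊡_ : ∀ {l m n} → Matrix l m → Matrix m n → Matrix l n
  (A ⊡ B) i j = sum (λ t → A i t * B t j)

  -- remQuot inverts (i , r) ↦ i * p + r, so this is the block matrix [aᵢⱼ B].
  _⊗_ : ∀ {m n p q} → Matrix m n → Matrix p q → Matrix (m ℕ.* p) (n ℕ.* q)
  _⊗_ {m} {n} {p} {q} A B i j =
    A (proj₁ (remQuot {m} p i)) (proj₁ (remQuot {n} q j)) *
    B (proj₂ (remQuot {m} p i)) (proj₂ (remQuot {n} q j))

  scalar : ∀ n → ℂ → Matrix n n
  scalar n a i j = if ⌊ i ≟ j ⌋ then a else 0ℂ

  castRows : ∀ {m m′ n} → .(m ≡ m′) → Matrix m n → Matrix m′ n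
  castRows eq A i j = A (cast (sym eq) i) j

  castCols : ∀ {m n n′} → .(n ≡ n′) → Matrix m n → Matrix m n′
  castCols eq A i j = A i (cast (sym eq) j)

  blockMatrix : ∀ {m m′ n n′} → Matrix m n → Matrix m n′ →
                Matrix m′ n → Matrix m′ n′ → Matrix (m ℕ.+ m′) (n ℕ.+ n′)
  blockMatrix {m} {n = n} A B C D i j =
    [ (λ i₁ → [ A i₁ , B i₁ ]′ (splitAt n j))
    , (λ i₂ → [ C i₂ , D i₂ ]′ (splitAt n j)) ]′ (splitAt m i)

  block : ∀ k n → Matrix (k ℕ.* n) (k ℕ.* n) → Fin k → Fin k → Matrix n n
  block k n A i j r t = A (combine i r) (combine j t)

  record IsHadamard {N} (H : Matrix N N) : Set ℓ₁ where
    field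
      unimodular : ∀ i j → ∣ H i j ∣² ℝ.≈ ℝ.1#
      orthogonal : H ⊡ H ᴴ ≋ scalar N (N · 1ℂ)

  record BH (N k : ℕ) (H : Matrix N N) : Set ℓ₁ where
    field
      isHadamard  : IsHadamard H
      rootOfUnity : ∀ i j → H i j ^ k ≈ 1ℂ

  -- As i ≤ k, the natural number j + (k ∸ i) represents j - i modulo k.
  circ : ∀ {k} → Vector ℂ k → Matrix k k
  circ {k} s i j = s (_mod_ (toℕ j ℕ.+ (k ℕ.∸ toℕ i)) k {{nonZeroIndex i}})

  fourier : ℂ → (k : ℕ) → Matrix k k
  fourier x k i j = x ^ (toℕ i ℕ.* toℕ j)

  ones : ∀ n → Matrix 1 n
  ones n _ _ = 1ℂ

  eigenvalue : ∀ {k} → ℂ → Vector ℂ k → Fin k → ℂ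
  eigenvalue x s m = sum (λ j → s j * x ^ (toℕ m ℕ.* toℕ j))

  -- ( S          F ⊗ jₙ )
  -- ( Fᴴ ⊗ jₙᵀ   A      )   with k * 1 rows (columns) of F ⊗ jₙ (Fᴴ ⊗ jₙᵀ) read as k.
  bordered : ∀ k n → ℂ → Matrix k k → Matrix (k ℕ.* n) (k ℕ.* n) →
             Matrix (k ℕ.+ k ℕ.* n) (k ℕ.+ k ℕ.* n)
  bordered k n x S A = blockMatrix
    S                                                     (castRows (*-identityʳ k) (fourier x k ⊗ ones n))
    (castCols (*-identityʳ k) (fourier x k ᴴ ⊗ ones n ᵀ)) A

  RowSums ColumnSums : ∀ {m n} → Matrix m n → ℂ → Set ℓ₁
  RowSums    A a = ∀ i → sum (λ j → A i j) ≈ a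
  ColumnSums A a = ∀ j → sum (λ i → A i j) ≈ a

{-# OPTIONS --safe #-}
module Submission where

-- Comparing the top left block of H Hᴴ = (k + kn) I with S Sᴴ = k I gives F Fᴴ = k I; that
-- xᵏ = 1 and that the entries of F are unimodular is read off the entries of H.  A top row
-- of H is orthogonal to the row (i , r), which with S F = F Λ reads
--     F Λ eᵢ + F b̄ = 0,   bⱼ the sum of row r of Aᵢⱼ,
-- and cancelling F yields bⱼ = - δᵢⱼ λ̄ᵢ.  For the columns, Hᴴ H = (k + kn) I as well, and
-- Fᴴ S = Λ Fᴴ gives the same system with Sᵀ and the conjugate of F in place of S and F.

open import Defs
open import Algebra.Apartness.Bundles using (HeytingCommutativeRing)
open import Algebra.Bundles using (CommutativeRing; Semiring)
open import Algebra.Consequences.Setoid using (comm∧idˡ⇒id; comm∧distrˡ⇒distr)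
open import Algebra.Definitions using (Involutive)
import Algebra.Definitions.RawSemiring as RawSemiringDefinitions
open import Algebra.Morphism.Structures using (IsRingHomomorphism)
open import Data.Bool.Base using (if_then_else_)
open import Data.Fin.Base using (Fin; zero; suc; toℕ; fromℕ<; cast; combine; remQuot; splitAt; _↑ˡ_; _↑ʳ_)
open import Data.Fin.Patterns using (1F)
open import Data.Fin.Permutation using (Permutation; permutation)
open import Data.Fin.Properties using (_≟_; nonZeroIndex; toℕ<n; toℕ-fromℕ<; toℕ-injective; suc-injective; toℕ-cast; toℕ-combine; remQuot-combine; splitAt-↑ˡ; splitAt-↑ʳ; ↑ˡ-injective)
open import Data.Nat.Base as ℕ using (ℕ; NonZero; _∸_; suc; s≤s)
open import Data.Nat.DivMod using (_%_; _/_; _mod_; m≡m%n+[m/n]*n; m<n⇒m%n≡m; [m+n]%n≡m%n; %-distribˡ-+; m%n%n≡m%n; m*n%n≡0)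
import Data.Nat.Properties as ℕ
open import Data.Product.Base using (_×_; _,_; proj₁; proj₂)
open import Data.Sum.Base using (inj₂; [_,_]′)
open import Data.Vec.Functional using (Vector)
open import Function.Base using (_∘_)
open import Function.Bundles using (Equivalence)
open import Level using (_⊔_) renaming (suc to lsuc)
open import Relation.Binary.PropositionalEquality.Core as ≡ using (_≡_; _≢_)
import Relation.Binary.PropositionalEquality.Properties as ≡
open import Relation.Binary.Bundles using (Setoid)
import Relation.Binary.Reasoning.Setoid as SetoidReasoning
open import Relation.Binary.Structures using (IsEquivalence; IsStrictPartialOrder)
open import Relation.Nullary.Decidable.Core using (⌊_⌋; yes; no)
open import Relation.Nullary.Negation.Core using (¬_; contradiction)

-- The obstacle is the statement about columns. H Hᴴ = N I, with N = k + kn, relates rows only, and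
-- passing to Hᴴ H = N I amounts to turning a right inverse into a left one. Equality in ℂ is not
-- assumed decidable, so there is no choosing of pivots for an elimination. The step rests on
-- positivity instead: ∑ v v̄ = 0 forces v = 0, and the diagonal of Hᴴ H is fixed beforehand by the
-- unimodular entries. This positivity and the cancellation of positive integers are all that the
-- argument takes from ℂ beyond ring laws and conjugation, so the linear algebra is carried out over
-- an abstract `HermitianRing`. The conjugate in - λ̄ᵢ has a simple origin: the inner product of two
-- rows conjugates the sums over A but turns the border Fᴴ back into F, so λᵢ stands unconjugated
-- beside b̄.

-- Residue arithmetic behind circulant matrices.

-- circ s i j is definitionally s (shift i j).
shift : ∀ {k} → Fin k → Fin k → Fin k
shift {k} i j = _mod_ (toℕ j ℕ.+ (k ∸ toℕ i)) k {{nonZeroIndex i}}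

toℕ-shift : ∀ {k} .{{_ : NonZero k}} (i j : Fin k) → toℕ (shift i j) ≡ (toℕ j ℕ.+ (k ∸ toℕ i)) % k
toℕ-shift i j = toℕ-fromℕ< _

[m%n+o]%n≡[m+o]%n : ∀ m o n .{{_ : NonZero n}} → (m % n ℕ.+ o) % n ≡ (m ℕ.+ o) % n
[m%n+o]%n≡[m+o]%n m o n = begin
  (m % n ℕ.+ o) % n           ≡⟨ %-distribˡ-+ (m % n) o n ⟩
  (m % n % n ℕ.+ o % n) % n   ≡⟨ ≡.cong (λ r → (r ℕ.+ o % n) % n) (m%n%n≡m%n m n) ⟩
  (m % n ℕ.+ o % n) % n       ≡⟨ %-distribˡ-+ m o n ⟨
  (m ℕ.+ o) % n               ∎
  where open ≡.≡-Reasoning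

i+[j+[k∸i]]≡j+k : ∀ {k} (i : Fin k) j → toℕ i ℕ.+ (j ℕ.+ (k ∸ toℕ i)) ≡ j ℕ.+ k
i+[j+[k∸i]]≡j+k {k} i j = begin
  toℕ i ℕ.+ (j ℕ.+ (k ∸ toℕ i))   ≡⟨ ℕ.+-comm (toℕ i) _ ⟩
  j ℕ.+ (k ∸ toℕ i) ℕ.+ toℕ i     ≡⟨ ℕ.+-assoc j _ _ ⟩
  j ℕ.+ (k ∸ toℕ i ℕ.+ toℕ i)     ≡⟨ ≡.cong (j ℕ.+_) (ℕ.m∸n+n≡m (ℕ.<⇒≤ (toℕ<n i))) ⟩
  j ℕ.+ k                         ∎
  where open ≡.≡-Reasoning

-- Together with `shift-unique` this frees all later arguments from truncated subtraction:
-- `shift i j` is from then on the one residue that solves i + m ≡ j modulo k.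
[i+shift]%k : ∀ {k} .{{_ : NonZero k}} (i j : Fin k) → (toℕ i ℕ.+ toℕ (shift i j)) % k ≡ toℕ j
[i+shift]%k {k} i j = begin
  (toℕ i ℕ.+ toℕ (shift i j)) % k                    ≡⟨ ≡.cong (_% k) (ℕ.+-comm (toℕ i) _) ⟩
  (toℕ (shift i j) ℕ.+ toℕ i) % k                    ≡⟨ ≡.cong (λ r → (r ℕ.+ toℕ i) % k) (toℕ-shift i j) ⟩
  ((toℕ j ℕ.+ (k ∸ toℕ i)) % k ℕ.+ toℕ i) % k        ≡⟨ [m%n+o]%n≡[m+o]%n (toℕ j ℕ.+ (k ∸ toℕ i)) (toℕ i) k ⟩
  (toℕ j ℕ.+ (k ∸ toℕ i) ℕ.+ toℕ i) % k              ≡⟨ ≡.cong (_% k) (ℕ.+-comm _ (toℕ i)) ⟩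
  (toℕ i ℕ.+ (toℕ j ℕ.+ (k ∸ toℕ i))) % k            ≡⟨ ≡.cong (_% k) (i+[j+[k∸i]]≡j+k i (toℕ j)) ⟩
  (toℕ j ℕ.+ k) % k                                  ≡⟨ [m+n]%n≡m%n (toℕ j) k ⟩
  toℕ j % k                                          ≡⟨ m<n⇒m%n≡m (toℕ<n j) ⟩
  toℕ j                                              ∎
  where open ≡.≡-Reasoning

shift-unique : ∀ {k} .{{_ : NonZero k}} (i j m : Fin k) →
               (toℕ i ℕ.+ toℕ m) % k ≡ toℕ j → shift i j ≡ m
shift-unique {k} i j m eq = toℕ-injective (begin
  toℕ (shift i j)                                          ≡⟨ toℕ-shift i j ⟩
  (toℕ j ℕ.+ (k ∸ toℕ i)) % k                              ≡⟨ ≡.cong (λ r → (r ℕ.+ (k ∸ toℕ i)) % k) eq ⟨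
  ((toℕ i ℕ.+ toℕ m) % k ℕ.+ (k ∸ toℕ i)) % k              ≡⟨ [m%n+o]%n≡[m+o]%n (toℕ i ℕ.+ toℕ m) (k ∸ toℕ i) k ⟩
  (toℕ i ℕ.+ toℕ m ℕ.+ (k ∸ toℕ i)) % k                    ≡⟨ ≡.cong (_% k) (ℕ.+-assoc (toℕ i) (toℕ m) _) ⟩
  (toℕ i ℕ.+ (toℕ m ℕ.+ (k ∸ toℕ i))) % k                  ≡⟨ ≡.cong (_% k) (i+[j+[k∸i]]≡j+k i (toℕ m)) ⟩
  (toℕ m ℕ.+ k) % k                                        ≡⟨ [m+n]%n≡m%n (toℕ m) k ⟩
  toℕ m % k                                                ≡⟨ m<n⇒m%n≡m (toℕ<n m) ⟩
  toℕ m                                                    ∎)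
  where open ≡.≡-Reasoning

shift-permutationʳ : ∀ {k} .{{_ : NonZero k}} → Fin k → Permutation k k
shift-permutationʳ {k} i = permutation (shift i) back
  (λ m → shift-unique i (back m) m (≡.sym (toℕ-fromℕ< _)))
  (λ j → toℕ-injective (≡.trans (toℕ-fromℕ< _) ([i+shift]%k i j)))
  where
  back : Fin k → Fin k
  back m = (toℕ i ℕ.+ toℕ m) mod k

-- Since j - (j - i) = i, the reflection is its own inverse, and one proof serves both inverse laws.
shift-permutationˡ : ∀ {k} .{{_ : NonZero k}} → Fin k → Permutation k k
shift-permutationˡ {k} j = permutation (λ i → shift i j) (λ i → shift i j) involutive involutive
  where
  involutive : ∀ i → shift (shift i j) j ≡ i
  involutive i = shift-unique (shift i j) j i
    (≡.trans (≡.cong (_% k) (ℕ.+-comm (toℕ (shift i j)) (toℕ i))) ([i+shift]%k i j))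

↑ˡ≢↑ʳ : ∀ {m n} (i : Fin m) (j : Fin n) → i ↑ˡ n ≢ m ↑ʳ j
↑ˡ≢↑ʳ {m} {n} i j eq
  with ≡.trans (≡.sym (splitAt-↑ˡ m i n)) (≡.trans (≡.cong (splitAt m) eq) (splitAt-↑ʳ m n j))
... | ()

-- Linear algebra over a commutative ring with a definite conjugation.

-- `definite` gives the orthogonality of the columns of H; `·-cancelˡ` replaces division by n when F
-- is isolated from H and by k when a system with matrix F is solved.
record HermitianRing c ℓ : Set (lsuc (c ⊔ ℓ)) where
  field
    commutativeRing : CommutativeRing c ℓ

  open CommutativeRing commutativeRing public
  open RawSemiringDefinitions (Semiring.rawSemiring semiring) public using (sum) renaming (_×_ to _·_)

  field
    conj                    : Carrier → Carrier
    conj-isRingHomomorphism : IsRingHomomorphism rawRing rawRing conj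
    conj-involutive         : Involutive _≈_ conj
    definite  : ∀ {n} (v : Vector Carrier n) → sum (λ i → v i * conj (v i)) ≈ 0# → ∀ i → v i ≈ 0#
    ·-cancelˡ : ∀ n .{{_ : NonZero n}} {a b} → n · a ≈ n · b → a ≈ b

module HermitianRingProperties {c ℓ} (R : HermitianRing c ℓ) where

  open HermitianRing R hiding (zero; sum; _·_)
  open IsRingHomomorphism conj-isRingHomomorphism using ()
    renaming (⟦⟧-cong to conj-cong; +-homo to conj-+; *-homo to conj-*; 0#-homo to conj-0#)
  open import Algebra.Properties.Ring ring using (-0#≈0#; -‿involutive; +-cancelˡ; +-inverseˡ-unique)
  open import Algebra.Properties.CommutativeSemigroup *-commutativeSemigroup using (x∙yz≈y∙xz)
  open import Algebra.Properties.Semiring.Exp semiring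
  open import Algebra.Properties.Semiring.Mult semiring
    renaming (_×_ to _·_)
  open import Algebra.Properties.Semiring.Sum semiring
  open import Relation.Binary.Reasoning.Setoid setoid

  -- Built exactly like the scalar matrix of the theorem, so that over ℂ the two agree
  -- definitionally and the orthogonality relations of S and H can be passed on unchanged.
  scalar : ∀ {n} → Carrier → Fin n → Fin n → Carrier
  scalar a i j = if ⌊ i ≟ j ⌋ then a else 0#

  scalar-≡ : ∀ {n a} {i j : Fin n} → i ≡ j → scalar a i j ≈ a
  scalar-≡ {i = i} {j} i≡j with i ≟ j
  ... | yes _   = refl
  ... | no  i≢j = contradiction i≡j i≢j

  scalar-≢ : ∀ {n a} {i j : Fin n} → i ≢ j → scalar a i j ≈ 0#
  scalar-≢ {i = i} {j} i≢j with i ≟ j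
  ... | yes i≡j = contradiction i≡j i≢j
  ... | no  _   = refl

  scalar-injective : ∀ {m n a} (f : Fin m → Fin n) → (∀ {i j} → f i ≡ f j → i ≡ j) →
                     ∀ i j → scalar a (f i) (f j) ≈ scalar a i j
  scalar-injective f inj i j with i ≟ j
  ... | yes i≡j = scalar-≡ (≡.cong f i≡j)
  ... | no  i≢j = scalar-≢ (i≢j ∘ inj)

  scalar-map : ∀ {n a} (f : Carrier → Carrier) → f 0# ≈ 0# →
               ∀ (i j : Fin n) → scalar (f a) i j ≈ f (scalar a i j)
  scalar-map f f0≈0 i j with i ≟ j
  ... | yes _ = refl
  ... | no  _ = sym f0≈0

  scalar-cong : ∀ {n a b} → a ≈ b → ∀ (i j : Fin n) → scalar a i j ≈ scalar b i j
  scalar-cong a≈b i j with i ≟ j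
  ... | yes _ = a≈b
  ... | no  _ = refl

  scalar-sym : ∀ {n a} (i j : Fin n) → scalar a i j ≈ scalar a j i
  scalar-sym i j with i ≟ j
  ... | yes i≡j = sym (scalar-≡ (≡.sym i≡j))
  ... | no  i≢j = sym (scalar-≢ (i≢j ∘ ≡.sym))

  ·-zeroʳ : ∀ n → n · 0# ≈ 0#
  ·-zeroʳ n = trans (sym (sum-replicate n)) (sum-replicate-zero n)

  sum-zero : ∀ {n} {f : Vector Carrier n} → (∀ i → f i ≈ 0#) → sum f ≈ 0#
  sum-zero {n} f≈0 = trans (sum-cong-≋ f≈0) (sum-replicate-zero n)

  sum-scalar-* : ∀ {n} a (i : Fin n) (f : Vector Carrier n) → sum (λ j → scalar a i j * f j) ≈ a * f i
  sum-scalar-* a zero    f = begin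
    a * f zero + sum (λ j → 0# * f (suc j))  ≈⟨ +-congˡ (sum-zero (zeroˡ ∘ f ∘ suc)) ⟩
    a * f zero + 0#                          ≈⟨ +-identityʳ _ ⟩
    a * f zero                               ∎
  sum-scalar-* a (suc i) f = begin
    0# * f zero + sum (λ j → scalar a (suc i) (suc j) * f (suc j))
      ≈⟨ +-cong (zeroˡ _) (sum-cong-≋ λ j → *-congʳ (scalar-injective suc suc-injective i j)) ⟩
    0# + sum (λ j → scalar a i j * f (suc j))
      ≈⟨ +-identityˡ _ ⟩
    sum (λ j → scalar a i j * f (suc j))
      ≈⟨ sum-scalar-* a i (f ∘ suc) ⟩
    a * f (suc i)  ∎

  sum-↑ : ∀ m {n} (f : Vector Carrier (m ℕ.+ n)) → sum f ≈ sum (λ i → f (i ↑ˡ n)) + sum (λ j → f (m ↑ʳ j))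
  sum-↑ ℕ.zero    f = sym (+-identityˡ _)
  sum-↑ (ℕ.suc m) f = trans (+-congˡ (sum-↑ m (f ∘ suc))) (sym (+-assoc _ _ _))

  sum-combine : ∀ k {n} (f : Vector Carrier (k ℕ.* n)) → sum f ≈ sum (λ (j : Fin k) → sum (λ u → f (combine j u)))
  sum-combine ℕ.zero        f = refl
  sum-combine (ℕ.suc k) {n} f = trans (sum-↑ n f) (+-congˡ (sum-combine k (f ∘ (n ↑ʳ_))))

  -- Associativity of the product a M b of a row, a matrix and a column.
  sum-assoc : ∀ {m n} (a : Vector Carrier m) (M : Fin m → Fin n → Carrier) (b : Vector Carrier n) →
              sum (λ i → a i * sum (λ j → M i j * b j)) ≈ sum (λ j → sum (λ i → a i * M i j) * b j)
  sum-assoc {m} {n} a M b = begin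
    sum (λ i → a i * sum (λ j → M i j * b j))     ≈⟨ sum-cong-≋ {m} (λ i → *-distribˡ-sum {n} (a i) _) ⟩
    sum (λ i → sum (λ j → a i * (M i j * b j)))   ≈⟨ ∑-comm {m} {n} _ ⟩
    sum (λ j → sum (λ i → a i * (M i j * b j)))   ≈⟨ sum-cong-≋ {n} (λ j → sum-cong-≋ {m} λ i → *-assoc _ _ _) ⟨
    sum (λ j → sum (λ i → a i * M i j * b j))     ≈⟨ sum-cong-≋ {n} (λ j → *-distribʳ-sum {m} (b j) _) ⟨
    sum (λ j → sum (λ i → a i * M i j) * b j)     ∎

  conj-sum : ∀ {n} (f : Vector Carrier n) → conj (sum f) ≈ sum (conj ∘ f)
  conj-sum {ℕ.zero}  f = conj-0#
  conj-sum {ℕ.suc n} f = trans (conj-+ _ _) (+-congˡ (conj-sum (f ∘ suc)))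

  conj-sum-* : ∀ {n} (f g : Vector Carrier n) → conj (sum (λ i → conj (f i) * g i)) ≈ sum (λ i → f i * conj (g i))
  conj-sum-* {n} f g = trans (conj-sum {n} _) (sum-cong-≋ {n} λ i → trans (conj-* _ _) (*-congʳ (conj-involutive _)))

  *-sum-conj : ∀ {n} a (f : Vector Carrier n) → sum (λ i → a * conj (f i)) ≈ a * conj (sum f)
  *-sum-conj {n} a f = sym (trans (*-congˡ (conj-sum f)) (*-distribˡ-sum {n} a _))

  ^-% : ∀ {k} .{{_ : NonZero k}} {y} → y ^ k ≈ 1# → ∀ m → y ^ m ≈ y ^ (m % k)
  ^-% {k} {y} y^k≈1 m = begin
    y ^ m                              ≡⟨ ≡.cong (y ^_) (m≡m%n+[m/n]*n m k) ⟩
    y ^ (m % k ℕ.+ m / k ℕ.* k)        ≈⟨ ^-homo-* y (m % k) _ ⟩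
    y ^ (m % k) * y ^ (m / k ℕ.* k)    ≡⟨ ≡.cong (λ e → y ^ (m % k) * y ^ e) (ℕ.*-comm (m / k) k) ⟩
    y ^ (m % k) * y ^ (k ℕ.* (m / k))  ≈⟨ *-congˡ (^-assocʳ y k (m / k)) ⟨
    y ^ (m % k) * (y ^ k) ^ (m / k)    ≈⟨ *-congˡ (^-congˡ (m / k) y^k≈1) ⟩
    y ^ (m % k) * 1# ^ (m / k)         ≈⟨ *-congˡ (1^ (m / k)) ⟩
    y ^ (m % k) * 1#                   ≈⟨ *-identityʳ _ ⟩
    y ^ (m % k)                        ∎
    where
    1^ : ∀ e → 1# ^ e ≈ 1#
    1^ ℕ.zero    = refl
    1^ (ℕ.suc e) = trans (*-identityˡ _) (1^ e)

  -- Eigenvectors of circulant matrices.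

  -- For y = x ^ i the powers of y form column i of F, and ∑ sⱼ yʲ is the eigenvalue λᵢ.
  module Circulant {k} .{{_ : NonZero k}} (s : Vector Carrier k) {y} (y^k≈1 : y ^ k ≈ 1#) where

    ^-shift : ∀ i j → y ^ toℕ i * y ^ toℕ (shift i j) ≈ y ^ toℕ j
    ^-shift i j = begin
      y ^ toℕ i * y ^ toℕ (shift i j)            ≈⟨ ^-homo-* y (toℕ i) _ ⟨
      y ^ (toℕ i ℕ.+ toℕ (shift i j))            ≈⟨ ^-% y^k≈1 _ ⟩
      y ^ ((toℕ i ℕ.+ toℕ (shift i j)) % k)      ≡⟨ ≡.cong (y ^_) ([i+shift]%k i j) ⟩
      y ^ toℕ j                                  ∎

    -- Splitting y ^ j as y ^ i times y ^ (j - i) takes y ^ i out of the sum; what remains depends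
    -- only on j - i, which permutes the indices as j varies.
    eigenvectorʳ : ∀ i → sum (λ j → s (shift i j) * y ^ toℕ j) ≈ y ^ toℕ i * sum (λ j → s j * y ^ toℕ j)
    eigenvectorʳ i = begin
      sum (λ j → s (shift i j) * y ^ toℕ j)
        ≈⟨ sum-cong-≋ {k} (λ j → trans (*-congˡ (sym (^-shift i j))) (x∙yz≈y∙xz _ _ _)) ⟩
      sum (λ j → y ^ toℕ i * (s (shift i j) * y ^ toℕ (shift i j)))
        ≈⟨ *-distribˡ-sum {k} (y ^ toℕ i) _ ⟨
      y ^ toℕ i * sum (λ j → s (shift i j) * y ^ toℕ (shift i j))
        ≈⟨ *-congˡ (sum-permute (λ j → s j * y ^ toℕ j) (shift-permutationʳ i)) ⟨
      y ^ toℕ i * sum (λ j → s j * y ^ toℕ j) ∎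

    -- Here i varies and j is fixed, so y ^ (j - i) has to be produced from the conjugate of y ^ i.
    -- Unimodularity makes conjugates inverses, whence conj (y ^ i) = conj (y ^ j) * y ^ (j - i).
    -- The reindexed sum is the same as for right eigenvectors, and so is the eigenvalue.
    eigenvectorˡ : (∀ (j : Fin k) → y ^ toℕ j * conj (y ^ toℕ j) ≈ 1#) →
                   ∀ j → sum (λ i → s (shift i j) * conj (y ^ toℕ i)) ≈ conj (y ^ toℕ j) * sum (λ i → s i * y ^ toℕ i)
    eigenvectorˡ unimodular j = begin
      sum (λ i → s (shift i j) * conj (y ^ toℕ i))
        ≈⟨ sum-cong-≋ {k} (λ i → trans (*-congˡ (conj-shift i)) (x∙yz≈y∙xz _ _ _)) ⟩
      sum (λ i → conj (y ^ toℕ j) * (s (shift i j) * y ^ toℕ (shift i j)))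
        ≈⟨ *-distribˡ-sum {k} (conj (y ^ toℕ j)) _ ⟨
      conj (y ^ toℕ j) * sum (λ i → s (shift i j) * y ^ toℕ (shift i j))
        ≈⟨ *-congˡ (sum-permute (λ i → s i * y ^ toℕ i) (shift-permutationˡ j)) ⟨
      conj (y ^ toℕ j) * sum (λ i → s i * y ^ toℕ i) ∎
      where
      conj-shift : ∀ i → conj (y ^ toℕ i) ≈ conj (y ^ toℕ j) * y ^ toℕ (shift i j)
      conj-shift i = sym (begin
        conj (y ^ toℕ j) * yσ                  ≈⟨ *-congʳ (conj-cong (^-shift i j)) ⟨
        conj (y ^ toℕ i * yσ) * yσ             ≈⟨ *-congʳ (conj-* _ _) ⟩
        conj (y ^ toℕ i) * conj yσ * yσ        ≈⟨ *-assoc _ _ _ ⟩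
        conj (y ^ toℕ i) * (conj yσ * yσ)      ≈⟨ *-congˡ (trans (*-comm _ _) (unimodular (shift i j))) ⟩
        conj (y ^ toℕ i) * 1#                  ≈⟨ *-identityʳ _ ⟩
        conj (y ^ toℕ i)                       ∎)
        where yσ = y ^ toℕ (shift i j)

  -- Orthogonality of columns and systems with an orthogonal matrix.

  -- The p-th column D of HᴴH - aI satisfies H D = 0, so it is orthogonal to the p-th column
  -- of HᴴH, and its p-th entry vanishes, so it is orthogonal to that of aI.  Hence D ⊥ D.
  columns-orthogonal : ∀ {N a} (H : Fin N → Fin N → Carrier) →
    (∀ r r′ → sum (λ q → H r q * conj (H r′ q)) ≈ scalar a r r′) →
    (∀ p → sum (λ r → conj (H r p) * H r p) ≈ a) →
    ∀ p q → sum (λ r → conj (H r q) * H r p) ≈ scalar a p q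
  columns-orthogonal {N} {a} H rows diagonal p q = begin
    G q                     ≈⟨ +-inverseˡ-unique _ _ (definite D ∣D∣²≈0 q) ⟩
    - scalar (- a) p q      ≈⟨ -‿cong (scalar-map (λ z → - z) -0#≈0# p q) ⟩
    - - scalar a p q        ≈⟨ -‿involutive _ ⟩
    scalar a p q            ∎
    where
    G D : Vector Carrier N
    G q = sum (λ r → conj (H r q) * H r p)
    D q = G q + scalar (- a) p q

    HD≈0 : ∀ r → sum (λ q → H r q * D q) ≈ 0#
    HD≈0 r = begin
      sum (λ q → H r q * D q)
        ≈⟨ sum-cong-≋ {N} (λ q → trans (distribˡ _ _ _) (+-congˡ (*-comm _ _))) ⟩
      sum (λ q → H r q * G q + scalar (- a) p q * H r q)
        ≈⟨ ∑-distrib-+ {N} (λ q → H r q * G q) _ ⟩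
      -- As `G` is column p of Hᴴ H, the first sum is an entry of H (Hᴴ H) = (H Hᴴ) H = a H, which
      -- the second one cancels.
      sum (λ q → H r q * G q) + sum (λ q → scalar (- a) p q * H r q)
        ≈⟨ +-cong (sum-assoc (H r) (λ q r′ → conj (H r′ q)) (λ r′ → H r′ p)) (sum-scalar-* (- a) p (H r)) ⟩
      sum (λ r′ → sum (λ q → H r q * conj (H r′ q)) * H r′ p) + - a * H r p
        ≈⟨ +-congʳ (sum-cong-≋ {N} λ r′ → *-congʳ (rows r r′)) ⟩
      sum (λ r′ → scalar a r r′ * H r′ p) + - a * H r p
        ≈⟨ +-congʳ (sum-scalar-* a r (λ r′ → H r′ p)) ⟩
      a * H r p + - a * H r p
        ≈⟨ distribʳ _ _ _ ⟨
      (a + - a) * H r p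
        ≈⟨ *-congʳ (-‿inverseʳ a) ⟩
      0# * H r p
        ≈⟨ zeroˡ _ ⟩
      0# ∎

    D*scalar≈0 : ∀ q → D q * conj (scalar (- a) p q) ≈ 0#
    D*scalar≈0 q with p ≟ q
    ... | yes ≡.refl = trans (*-congʳ (trans (+-congʳ (diagonal p)) (-‿inverseʳ a))) (zeroˡ _)
    ... | no  _      = trans (*-congˡ conj-0#) (zeroʳ _)

    ∣D∣²≈0 : sum (λ q → D q * conj (D q)) ≈ 0#
    ∣D∣²≈0 = begin
      sum (λ q → D q * conj (D q))
        ≈⟨ sum-cong-≋ {N} (λ q → trans (*-congˡ (conj-+ _ _)) (distribˡ _ _ _)) ⟩
      sum (λ q → D q * conj (G q) + D q * conj (scalar (- a) p q))
        ≈⟨ sum-cong-≋ {N} (λ q → trans (+-congˡ (D*scalar≈0 q)) (+-identityʳ _)) ⟩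
      sum (λ q → D q * conj (G q))
        ≈⟨ sum-cong-≋ {N} (λ q → *-congˡ (conj-sum-* (λ r → H r q) (λ r → H r p))) ⟩
      sum (λ q → D q * sum (λ r → H r q * conj (H r p)))
        ≈⟨ sum-assoc D (λ q r → H r q) (λ r → conj (H r p)) ⟩
      sum (λ r → sum (λ q → D q * H r q) * conj (H r p))
        ≈⟨ sum-zero {N} (λ r → trans (*-congʳ (trans (sum-cong-≋ {N} λ q → *-comm _ _) (HD≈0 r))) (zeroˡ _)) ⟩
      0# ∎

  -- With g = b̄ + μ eᵢ the system reads F g = 0. Multiplying by Fᴴ from the left leaves k g = 0,
  -- and k cancels. F is kept arbitrary because the rows of A lead to the Fourier matrix and the
  -- columns of A to its conjugate.
  solve-orthogonal : ∀ {k} .{{_ : NonZero k}} (F : Fin k → Fin k → Carrier) →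
    (∀ m j → sum (λ l → conj (F l m) * F l j) ≈ scalar (k · 1#) m j) →
    ∀ μ i (b : Vector Carrier k) → (∀ l → F l i * μ + sum (λ j → F l j * conj (b j)) ≈ 0#) →
    ∀ j → b j ≈ - conj (scalar μ i j)
  solve-orthogonal {k} F orthogonal μ i b system j =
    +-inverseˡ-unique _ _ (begin
      b j + conj (scalar μ i j)                ≈⟨ +-congʳ (conj-involutive (b j)) ⟨
      conj (conj (b j)) + conj (scalar μ i j)  ≈⟨ conj-+ _ _ ⟨
      conj (g j)                               ≈⟨ conj-cong g≈0 ⟩
      conj 0#                                  ≈⟨ conj-0# ⟩
      0#                                       ∎)
    where
    g : Vector Carrier k
    g j = conj (b j) + scalar μ i j

    Fg≈0 : ∀ l → sum (λ j → F l j * g j) ≈ 0#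
    Fg≈0 l = begin
      sum (λ j → F l j * g j)
        ≈⟨ sum-cong-≋ {k} (λ j → trans (distribˡ _ _ _) (+-congˡ (*-comm _ _))) ⟩
      sum (λ j → F l j * conj (b j) + scalar μ i j * F l j)
        ≈⟨ ∑-distrib-+ {k} (λ j → F l j * conj (b j)) _ ⟩
      sum (λ j → F l j * conj (b j)) + sum (λ j → scalar μ i j * F l j)
        ≈⟨ +-congˡ (sum-scalar-* μ i (F l)) ⟩
      sum (λ j → F l j * conj (b j)) + μ * F l i
        ≈⟨ +-comm _ _ ⟩
      μ * F l i + sum (λ j → F l j * conj (b j))
        ≈⟨ +-congʳ (*-comm _ _) ⟩
      F l i * μ + sum (λ j → F l j * conj (b j))
        ≈⟨ system l ⟩
      0# ∎

    g≈0 : g j ≈ 0#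
    g≈0 = ·-cancelˡ k (begin
      k · g j                                                ≈⟨ ×-congʳ k (*-identityˡ (g j)) ⟨
      k · (1# * g j)                                         ≈⟨ ×-assoc-* k 1# (g j) ⟨
      k · 1# * g j                                           ≈⟨ sum-scalar-* (k · 1#) j g ⟨
      sum (λ m → scalar (k · 1#) j m * g m)                  ≈⟨ sum-cong-≋ {k} (λ m → *-congʳ (orthogonal j m)) ⟨
      sum (λ m → sum (λ l → conj (F l j) * F l m) * g m)     ≈⟨ sum-assoc (λ l → conj (F l j)) F g ⟨
      sum (λ l → conj (F l j) * sum (λ m → F l m * g m))     ≈⟨ sum-zero {k} (λ l → trans (*-congˡ (Fg≈0 l)) (zeroʳ _)) ⟩
      0#                                                     ≈⟨ ·-zeroʳ k ⟨
      k · 0#                                                 ∎)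

  -- Hadamard matrices bordered by a circulant and a Fourier matrix.

  -- The hypotheses read block by block, with A indexed by pairs (block, position), so that the
  -- argument meets no Kronecker products, casts or case splits on indices.
  record IsBorderedHadamard {k n} (s : Vector Carrier k) (x : Carrier)
    (A : Fin k → Fin n → Fin k → Fin n → Carrier)
    (H : Fin (k ℕ.+ k ℕ.* n) → Fin (k ℕ.+ k ℕ.* n) → Carrier) : Set ℓ where

    F : Fin k → Fin k → Carrier
    F l j = x ^ (toℕ l ℕ.* toℕ j)

    top : Fin k → Fin (k ℕ.+ k ℕ.* n)
    top l = l ↑ˡ k ℕ.* n

    bottom : Fin k → Fin n → Fin (k ℕ.+ k ℕ.* n)
    bottom i r = k ↑ʳ combine i r

    field
      x^k≈1        : x ^ k ≈ 1#
      S-orthogonal : ∀ l l′ → sum (λ t → s (shift l t) * conj (s (shift l′ t))) ≈ scalar (k · 1#) l l′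
      H-unimodular : ∀ p q → H p q * conj (H p q) ≈ 1#
      H-orthogonal : ∀ p q → sum (λ t → H p t * conj (H q t)) ≈ scalar ((k ℕ.+ k ℕ.* n) · 1#) p q
      H-S  : ∀ l t → H (top l) (top t) ≈ s (shift l t)
      H-F  : ∀ l j u → H (top l) (bottom j u) ≈ F l j
      H-Fᴴ : ∀ i r t → H (bottom i r) (top t) ≈ conj (F t i)
      H-A  : ∀ i r j u → H (bottom i r) (bottom j u) ≈ A i r j u

  -- The index `u₀` witnesses n ≥ 1: it selects the copy of F inside F ⊗ jₙ from which unimodularity
  -- is read, and it makes n cancellable.
  module BorderedHadamard {k n} .{{_ : NonZero k}} (u₀ : Fin n) {s x A H}
    (H-isBordered : IsBorderedHadamard {k} {n} s x A H) where

    open IsBorderedHadamard H-isBordered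

    private instance
      n≢0 : NonZero n
      n≢0 = nonZeroIndex u₀

    sum-split : (f : Vector Carrier (k ℕ.+ k ℕ.* n)) →
                sum f ≈ sum (λ t → f (top t)) + sum (λ j → sum (λ u → f (bottom j u)))
    sum-split f = trans (sum-↑ k f) (+-congˡ (sum-combine k (λ q → f (k ↑ʳ q))))

    F-sym : ∀ l j → F l j ≡ F j l
    F-sym l j = ≡.cong (x ^_) (ℕ.*-comm (toℕ l) (toℕ j))

    F-unimodular : ∀ l j → F l j * conj (F l j) ≈ 1#
    F-unimodular l j = begin
      F l j * conj (F l j)                                    ≈⟨ *-cong (H-F l j u₀) (conj-cong (H-F l j u₀)) ⟨
      H (top l) (bottom j u₀) * conj (H (top l) (bottom j u₀)) ≈⟨ H-unimodular _ _ ⟩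
      1#                                                      ∎

    -- Subtract S Sᴴ = k I from the top left block S Sᴴ + n F Fᴴ = (k + kn) I of H Hᴴ.
    F-orthogonal : ∀ l l′ → sum (λ j → F l j * conj (F l′ j)) ≈ scalar (k · 1#) l l′
    F-orthogonal l l′ = ·-cancelˡ n (+-cancelˡ K _ _ (begin
      K + n · sum (λ j → F l j * conj (F l′ j))
        ≈⟨ +-cong (S-orthogonal l l′) (sum-replicate n) ⟨
      -- The multiple by n becomes a sum over the n copies that jₙ makes of every column of F.
      sum (λ t → s (shift l t) * conj (s (shift l′ t))) + sum {n} (λ _ → sum (λ j → F l j * conj (F l′ j)))
        ≈⟨ +-congˡ (∑-comm {k} {n} _) ⟨
      sum (λ t → s (shift l t) * conj (s (shift l′ t))) + sum (λ j → sum {n} (λ _ → F l j * conj (F l′ j)))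
        ≈⟨ +-cong (sum-cong-≋ {k} λ t → *-cong (H-S l t) (conj-cong (H-S l′ t)))
                  (sum-cong-≋ {k} λ j → sum-cong-≋ {n} λ u → *-cong (H-F l j u) (conj-cong (H-F l′ j u))) ⟨
      sum (λ t → H (top l) (top t) * conj (H (top l′) (top t)))
        + sum (λ j → sum (λ u → H (top l) (bottom j u) * conj (H (top l′) (bottom j u))))
        ≈⟨ sum-split (λ q → H (top l) q * conj (H (top l′) q)) ⟨
      sum (λ q → H (top l) q * conj (H (top l′) q))
        ≈⟨ H-orthogonal (top l) (top l′) ⟩
      scalar ((k ℕ.+ k ℕ.* n) · 1#) (top l) (top l′)
        ≈⟨ scalar-injective top (↑ˡ-injective (k ℕ.* n) _ _) l l′ ⟩
      scalar ((k ℕ.+ k ℕ.* n) · 1#) l l′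
        ≈⟨ scalar-cong [k+kn]·1≈ l l′ ⟩
      scalar (k · 1# + n · (k · 1#)) l l′
        ≈⟨ scalar-map (λ z → z + n · z) (trans (+-identityˡ _) (·-zeroʳ n)) l l′ ⟩
      K + n · K ∎))
      where
      K = scalar (k · 1#) l l′

      [k+kn]·1≈ : (k ℕ.+ k ℕ.* n) · 1# ≈ k · 1# + n · (k · 1#)
      [k+kn]·1≈ = begin
        (k ℕ.+ k ℕ.* n) · 1#        ≈⟨ ×-homo-+ 1# k _ ⟩
        k · 1# + (k ℕ.* n) · 1#     ≡⟨ ≡.cong (λ e → k · 1# + e · 1#) (ℕ.*-comm k n) ⟩
        k · 1# + (n ℕ.* k) · 1#     ≈⟨ +-congˡ (×-assocˡ 1# n k) ⟨
        k · 1# + n · (k · 1#)       ∎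

    -- F is symmetric, so for F the passage from rows to columns is an exchange of indices. This
    -- form serves the columns of A, the next one the rows.
    Fᴴ-orthogonal : ∀ m j → sum (λ l → conj (conj (F l m)) * conj (F l j)) ≈ scalar (k · 1#) m j
    Fᴴ-orthogonal m j = begin
      sum (λ l → conj (conj (F l m)) * conj (F l j))
        ≈⟨ sum-cong-≋ {k} (λ l → *-cong (trans (conj-involutive _) (reflexive (F-sym l m)))
                                        (reflexive (≡.cong conj (F-sym l j)))) ⟩
      sum (λ l → F m l * conj (F j l))
        ≈⟨ F-orthogonal m j ⟩
      scalar (k · 1#) m j ∎

    F-orthogonal-columns : ∀ m j → sum (λ l → conj (F l m) * F l j) ≈ scalar (k · 1#) m j
    F-orthogonal-columns m j = begin
      sum (λ l → conj (F l m) * F l j)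
        ≈⟨ sum-cong-≋ {k} (λ l → trans (*-comm _ _) (*-congʳ (sym (conj-involutive _)))) ⟩
      sum (λ l → conj (conj (F l j)) * conj (F l m))
        ≈⟨ Fᴴ-orthogonal j m ⟩
      scalar (k · 1#) j m
        ≈⟨ scalar-sym j m ⟩
      scalar (k · 1#) m j ∎

    eigenvalue : Vector Carrier k
    eigenvalue i = sum (λ j → s j * F i j)

    module _ (i : Fin k) where
      y : Carrier
      y = x ^ toℕ i

      y^ : ∀ j → y ^ toℕ j ≈ F i j
      y^ j = ^-assocʳ x (toℕ i) (toℕ j)

      y^k≈1 : y ^ k ≈ 1#
      y^k≈1 = begin
        (x ^ toℕ i) ^ k    ≈⟨ ^-assocʳ x (toℕ i) k ⟩
        x ^ (toℕ i ℕ.* k)  ≈⟨ ^-% x^k≈1 _ ⟩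
        x ^ ((toℕ i ℕ.* k) % k) ≡⟨ ≡.cong (x ^_) (m*n%n≡0 (toℕ i) k) ⟩
        1#                 ∎

      open Circulant s y^k≈1

      y^≈F : ∀ j → y ^ toℕ j ≈ F j i
      y^≈F j = trans (y^ j) (reflexive (F-sym i j))

      S-eigenvectorʳ : ∀ l → sum (λ t → s (shift l t) * F t i) ≈ F l i * eigenvalue i
      S-eigenvectorʳ l = begin
        sum (λ t → s (shift l t) * F t i)               ≈⟨ sum-cong-≋ {k} (λ t → *-congˡ (y^≈F t)) ⟨
        sum (λ t → s (shift l t) * y ^ toℕ t)           ≈⟨ eigenvectorʳ l ⟩
        y ^ toℕ l * sum (λ j → s j * y ^ toℕ j)         ≈⟨ *-cong (y^≈F l) (sum-cong-≋ {k} λ j → *-congˡ (y^ j)) ⟩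
        F l i * eigenvalue i                            ∎

      S-eigenvectorˡ : ∀ l → sum (λ t → s (shift t l) * conj (F t i)) ≈ conj (F l i) * eigenvalue i
      S-eigenvectorˡ l = begin
        sum (λ t → s (shift t l) * conj (F t i))        ≈⟨ sum-cong-≋ {k} (λ t → *-congˡ (conj-cong (y^≈F t))) ⟨
        sum (λ t → s (shift t l) * conj (y ^ toℕ t))    ≈⟨ eigenvectorˡ y-unimodular l ⟩
        conj (y ^ toℕ l) * sum (λ j → s j * y ^ toℕ j)  ≈⟨ *-cong (conj-cong (y^≈F l)) (sum-cong-≋ {k} λ j → *-congˡ (y^ j)) ⟩
        conj (F l i) * eigenvalue i                     ∎
        where
        y-unimodular : ∀ (j : Fin k) → y ^ toℕ j * conj (y ^ toℕ j) ≈ 1#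
        y-unimodular j = trans (*-cong (y^ j) (conj-cong (y^ j))) (F-unimodular i j)

    rowSums : ∀ i r j → sum (λ u → A i r j u) ≈ - conj (scalar (eigenvalue i) i j)
    rowSums i r = solve-orthogonal F F-orthogonal-columns (eigenvalue i) i _ λ l → begin
      F l i * eigenvalue i + sum (λ j → F l j * conj (sum (λ u → A i r j u)))
        ≈⟨ +-cong (S-eigenvectorʳ i l) (sum-cong-≋ {k} λ j → *-sum-conj (F l j) (A i r j)) ⟨
      -- The left border is Fᴴ and the inner product conjugates it once more, so the part over S is
      -- the entry (l , i) of S F.
      sum (λ t → s (shift l t) * F t i) + sum (λ j → sum (λ u → F l j * conj (A i r j u)))
        ≈⟨ +-cong (sum-cong-≋ {k} λ t → *-cong (H-S l t) (trans (conj-cong (H-Fᴴ i r t)) (conj-involutive _)))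
                  (sum-cong-≋ {k} λ j → sum-cong-≋ {n} λ u → *-cong (H-F l j u) (conj-cong (H-A i r j u))) ⟨
      sum (λ t → H (top l) (top t) * conj (H (bottom i r) (top t)))
        + sum (λ j → sum (λ u → H (top l) (bottom j u) * conj (H (bottom i r) (bottom j u))))
        ≈⟨ sum-split (λ q → H (top l) q * conj (H (bottom i r) q)) ⟨
      sum (λ q → H (top l) q * conj (H (bottom i r) q))
        ≈⟨ H-orthogonal (top l) (bottom i r) ⟩
      scalar ((k ℕ.+ k ℕ.* n) · 1#) (top l) (bottom i r)
        ≈⟨ scalar-≢ {i = top l} {bottom i r} (↑ˡ≢↑ʳ l (combine i r)) ⟩
      0# ∎

    -- The squared norm of a column counts its unimodular entries, which supplies the diagonal that
    -- `columns-orthogonal` asks for.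
    H-orthogonal-columns : ∀ p q → sum (λ r → conj (H r q) * H r p) ≈ scalar ((k ℕ.+ k ℕ.* n) · 1#) p q
    H-orthogonal-columns = columns-orthogonal H H-orthogonal λ p → begin
      sum (λ r → conj (H r p) * H r p)  ≈⟨ sum-cong-≋ {k ℕ.+ k ℕ.* n} (λ r → trans (*-comm _ _) (H-unimodular r p)) ⟩
      sum {k ℕ.+ k ℕ.* n} (λ _ → 1#)    ≈⟨ sum-replicate (k ℕ.+ k ℕ.* n) ⟩
      (k ℕ.+ k ℕ.* n) · 1#              ∎

    columnSums : ∀ i r j → sum (λ u → A j u i r) ≈ - conj (scalar (eigenvalue i) i j)
    columnSums i r = solve-orthogonal (λ l j → conj (F l j)) Fᴴ-orthogonal (eigenvalue i) i _ λ l → begin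
      conj (F l i) * eigenvalue i + sum (λ j → conj (F l j) * conj (sum (λ u → A j u i r)))
        ≈⟨ +-cong (S-eigenvectorˡ i l) (sum-cong-≋ {k} λ j → *-sum-conj (conj (F l j)) (λ u → A j u i r)) ⟨
      -- In a product of columns the upper border F is conjugated while the left border Fᴴ is not;
      -- both therefore contribute the conjugate of F.
      sum (λ t → s (shift t l) * conj (F t i)) + sum (λ j → sum (λ u → conj (F l j) * conj (A j u i r)))
        ≈⟨ +-cong (sum-cong-≋ {k} λ t → trans (*-comm _ _) (*-cong (H-S t l) (conj-cong (H-F t i r))))
                  (sum-cong-≋ {k} λ j → sum-cong-≋ {n} λ u → trans (*-comm _ _) (*-cong (H-Fᴴ j u l) (conj-cong (H-A j u i r)))) ⟨
      sum (λ t → conj (H (top t) (bottom i r)) * H (top t) (top l))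
        + sum (λ j → sum (λ u → conj (H (bottom j u) (bottom i r)) * H (bottom j u) (top l)))
        ≈⟨ sum-split (λ q → conj (H q (bottom i r)) * H q (top l)) ⟨
      sum (λ q → conj (H q (bottom i r)) * H q (top l))
        ≈⟨ H-orthogonal-columns (top l) (bottom i r) ⟩
      scalar ((k ℕ.+ k ℕ.* n) · 1#) (top l) (bottom i r)
        ≈⟨ scalar-≢ {i = top l} {bottom i r} (↑ˡ≢↑ʳ l (combine i r)) ⟩
      0# ∎

-- Ring laws of ℂ in real and imaginary parts.

-- The semiring solver has no negation, so negations are moved into the factors,
-- which leaves semiring identities with - d and - f as further variables d′ and f′.
module ComponentIdentities {c ℓ} (R : CommutativeRing c ℓ) where

  open CommutativeRing R
  open import Algebra.Properties.Ring ring
  open import Algebra.Solver.Ring.NaturalCoefficients.Default commutativeSemiring using (solve; _:=_; _:+_; _:*_)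
  open SetoidReasoning setoid

  *-assoc-re : ∀ a b c d e f → (a * c - b * d) * e - (a * d + b * c) * f ≈ a * (c * e - d * f) - b * (c * f + d * e)
  *-assoc-re a b c d e f = begin
    (a * c - b * d) * e - (a * d + b * c) * f
      ≈⟨ +-cong (*-congʳ (+-congˡ (-‿distribʳ-* b d))) (-‿distribʳ-* _ f) ⟩
    (a * c + b * - d) * e + (a * d + b * c) * - f
      ≈⟨ solve 8 (λ a b c d e f d′ f′ →
           (a :* c :+ b :* d′) :* e :+ (a :* d :+ b :* c) :* f′ :=
           a :* (c :* e :+ d :* f′) :+ b :* (c :* f′ :+ d′ :* e)) refl a b c d e f (- d) (- f) ⟩
    a * (c * e + d * - f) + b * (c * - f + - d * e)
      ≈⟨ +-cong (*-congˡ (+-congˡ (-‿distribʳ-* d f))) (*-congˡ (+-cong (-‿distribʳ-* c f) (-‿distribˡ-* d e))) ⟨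
    a * (c * e - d * f) + b * (- (c * f) - d * e)
      ≈⟨ +-congˡ (*-congˡ (-‿+-comm (c * f) (d * e))) ⟩
    a * (c * e - d * f) + b * - (c * f + d * e)
      ≈⟨ +-congˡ (-‿distribʳ-* b _) ⟨
    a * (c * e - d * f) - b * (c * f + d * e) ∎

  *-assoc-im : ∀ a b c d e f → (a * c - b * d) * f + (a * d + b * c) * e ≈ a * (c * f + d * e) + b * (c * e - d * f)
  *-assoc-im a b c d e f = begin
    (a * c - b * d) * f + (a * d + b * c) * e      ≈⟨ +-congʳ (*-congʳ (+-congˡ (-‿distribʳ-* b d))) ⟩
    (a * c + b * - d) * f + (a * d + b * c) * e
      ≈⟨ solve 7 (λ a b c d e f d′ →
           (a :* c :+ b :* d′) :* f :+ (a :* d :+ b :* c) :* e :=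
           a :* (c :* f :+ d :* e) :+ b :* (c :* e :+ d′ :* f)) refl a b c d e f (- d) ⟩
    a * (c * f + d * e) + b * (c * e + - d * f)    ≈⟨ +-congˡ (*-congˡ (+-congˡ (-‿distribˡ-* d f))) ⟨
    a * (c * f + d * e) + b * (c * e - d * f)      ∎

  *-distribˡ-im : ∀ a b c d e f → a * (d + f) + b * (c + e) ≈ (a * d + b * c) + (a * f + b * e)
  *-distribˡ-im = solve 6 (λ a b c d e f →
    a :* (d :+ f) :+ b :* (c :+ e) := (a :* d :+ b :* c) :+ (a :* f :+ b :* e)) refl

  *-distribˡ-re : ∀ a b c d e f → a * (c + e) - b * (d + f) ≈ (a * c - b * d) + (a * e - b * f)
  *-distribˡ-re a b c d e f = begin
    a * (c + e) - b * (d + f)                      ≈⟨ +-congˡ (-‿distribˡ-* b _) ⟩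
    -- The identity for imaginary parts, with - b for b and the components of both right factors
    -- exchanged.
    a * (c + e) + - b * (d + f)                    ≈⟨ *-distribˡ-im a (- b) d c f e ⟩
    (a * c + - b * d) + (a * e + - b * f)          ≈⟨ +-cong (+-congˡ (-‿distribˡ-* b d)) (+-congˡ (-‿distribˡ-* b f)) ⟨
    (a * c - b * d) + (a * e - b * f)              ∎

  *-comm-re : ∀ a b c d → a * c - b * d ≈ c * a - d * b
  *-comm-re a b c d = +-cong (*-comm a c) (-‿cong (*-comm b d))

  *-comm-im : ∀ a b c d → a * d + b * c ≈ c * b + d * a
  *-comm-im a b c d = trans (+-comm _ _) (+-cong (*-comm b c) (*-comm a d))

  -a*-b≈a*b : ∀ a b → - a * - b ≈ a * b
  -a*-b≈a*b a b = begin
    - a * - b      ≈⟨ -‿distribˡ-* a (- b) ⟨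
    - (a * - b)    ≈⟨ -‿cong (-‿distribʳ-* a b) ⟨
    - - (a * b)    ≈⟨ -‿involutive _ ⟩
    a * b          ∎

  conj-*-re : ∀ a b c d → a * c - b * d ≈ a * c - - b * - d
  conj-*-re a b c d = +-congˡ (-‿cong (sym (-a*-b≈a*b b d)))

  conj-*-im : ∀ a b c d → - (a * d + b * c) ≈ a * - d + - b * c
  conj-*-im a b c d = trans (sym (-‿+-comm (a * d) (b * c))) (+-cong (-‿distribʳ-* a d) (-‿distribˡ-* b c))

  z*conj-z-re : ∀ a b → a * a - b * - b ≈ a * a + b * b
  z*conj-z-re a b = +-congˡ (trans (-‿distribˡ-* b (- b)) (-a*-b≈a*b b b))

  z*conj-z-im : ∀ a b → a * - b + b * a ≈ 0#
  z*conj-z-im a b = begin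
    a * - b + b * a     ≈⟨ +-cong (-‿distribʳ-* a b) (*-comm a b) ⟨
    - (a * b) + a * b   ≈⟨ -‿inverseˡ _ ⟩
    0#                  ∎

  *-identityˡ-re : ∀ a b → 1# * a - 0# * b ≈ a
  *-identityˡ-re a b = trans (+-cong (*-identityˡ a) (trans (-‿cong (zeroˡ b)) -0#≈0#)) (+-identityʳ a)

  *-identityˡ-im : ∀ a b → 1# * b + 0# * a ≈ b
  *-identityˡ-im a b = trans (+-cong (*-identityˡ b) (zeroˡ a)) (+-identityʳ b)

-- Squares and sums in the constructive ordered field of reals.

module OrderedField {c ℓ₁ ℓ₂} (R : RealField c ℓ₁ ℓ₂) where

  open RealField R hiding (zero) renaming (sym to ≈-sym; trans to ≈-trans)
  open CommutativeRing (HeytingCommutativeRing.commutativeRing heytingCommutativeRing)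
    using (ring; semiring)
  open ComponentIdentities (HeytingCommutativeRing.commutativeRing heytingCommutativeRing) using (-a*-b≈a*b)
  open import Algebra.Properties.Ring ring using (-0#≈0#)
  open import Algebra.Properties.Semiring.Mult semiring using (×-assoc-*; ×-congʳ)
  open import Algebra.Properties.Semiring.Sum semiring using (sum)
  open IsStrictPartialOrder isStrictPartialOrder using (irrefl; asym)

  <-resp-≈ : ∀ {a b c d} → a ≈ b → c ≈ d → a < c → b < d
  <-resp-≈ a≈b c≈d a<c = <-respˡ-≈ a≈b (<-respʳ-≈ c≈d a<c)

  -- Tightness of apartness takes the place of trichotomy: the equations that the order yields below
  -- come, directly or indirectly, from refuting both strict inequalities.
  ≮∧≯⇒≈ : ∀ {a b} → ¬ a < b → ¬ b < a → a ≈ b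
  ≮∧≯⇒≈ {a} {b} a≮b b≮a = proj₁ (tight a b) ([ a≮b , b≮a ]′ ∘ Equivalence.to #⇔<⊎>)

  <0⇒0<- : ∀ {a} → a < 0# → 0# < - a
  <0⇒0<- {a} a<0 = <-resp-≈ (-‿inverseʳ a) (+-identityˡ (- a)) (+-monoˡ-< (- a) a<0)

  >0⇒0<a*a : ∀ {a} → 0# < a → 0# < a * a
  >0⇒0<a*a 0<a = *-pos 0<a 0<a

  <0⇒0<a*a : ∀ {a} → a < 0# → 0# < a * a
  <0⇒0<a*a a<0 = <-respʳ-≈ (-a*-b≈a*b _ _) (>0⇒0<a*a (<0⇒0<- a<0))

  a*a≈0⇒a≈0 : ∀ {a} → a * a ≈ 0# → a ≈ 0#
  a*a≈0⇒a≈0 a²≈0 = ≮∧≯⇒≈ (irrefl (≈-sym a²≈0) ∘ <0⇒0<a*a) (irrefl (≈-sym a²≈0) ∘ >0⇒0<a*a)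

  -- A negative square would exclude both signs of a, since either makes the square positive; then a
  -- = 0 and the square is 0 after all.
  0≤a*a : ∀ a → 0# ≤ a * a
  0≤a*a a a²<0 = irrefl (≈-trans (*-congʳ a≈0) (zeroˡ a)) a²<0
    where
    a≈0 : a ≈ 0#
    a≈0 = ≮∧≯⇒≈ (asym a²<0 ∘ <0⇒0<a*a) (asym a²<0 ∘ >0⇒0<a*a)

  b<a+b : ∀ {a b} → 0# < a → b < a + b
  b<a+b {a} {b} 0<a = <-respˡ-≈ (+-identityˡ b) (+-monoˡ-< b 0<a)

  -- Suppose a + b < 0. Then 0 < a is impossible, as it gives b < a + b < 0; hence a = 0, and b
  -- itself is negative.
  +-nonneg : ∀ {a b} → 0# ≤ a → 0# ≤ b → 0# ≤ a + b
  +-nonneg {a} {b} 0≤a 0≤b a+b<0 = 0≤b (<-respˡ-≈ (≈-trans (+-congʳ a≈0) (+-identityˡ b)) a+b<0)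
    where
    a≈0 : a ≈ 0#
    a≈0 = ≮∧≯⇒≈ 0≤a (λ 0<a → 0≤b (<-trans (b<a+b 0<a) a+b<0))

  a+b≈0⇒a≈0 : ∀ {a b} → 0# ≤ a → 0# ≤ b → a + b ≈ 0# → a ≈ 0#
  a+b≈0⇒a≈0 0≤a 0≤b a+b≈0 = ≮∧≯⇒≈ 0≤a (λ 0<a → 0≤b (<-respʳ-≈ a+b≈0 (b<a+b 0<a)))

  a+b≈0⇒b≈0 : ∀ {a b} → 0# ≤ a → 0# ≤ b → a + b ≈ 0# → b ≈ 0#
  a+b≈0⇒b≈0 0≤a 0≤b a+b≈0 = a+b≈0⇒a≈0 0≤b 0≤a (≈-trans (+-comm _ _) a+b≈0)

  sum-nonneg : ∀ {n} {f : Vector Carrier n} → (∀ i → 0# ≤ f i) → 0# ≤ sum f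
  sum-nonneg {ℕ.zero}  0≤f = irrefl refl
  sum-nonneg {ℕ.suc n} 0≤f = +-nonneg (0≤f zero) (sum-nonneg (0≤f ∘ suc))

  sum≈0⇒≈0 : ∀ {n} {f : Vector Carrier n} → (∀ i → 0# ≤ f i) → sum f ≈ 0# → ∀ i → f i ≈ 0#
  sum≈0⇒≈0 0≤f Σf≈0 zero    = a+b≈0⇒a≈0 (0≤f zero) (sum-nonneg (0≤f ∘ suc)) Σf≈0
  sum≈0⇒≈0 0≤f Σf≈0 (suc i) = sum≈0⇒≈0 (0≤f ∘ suc) (a+b≈0⇒b≈0 (0≤f zero) (sum-nonneg (0≤f ∘ suc)) Σf≈0) i

  ·-cancelˡ : ∀ n .{{_ : NonZero n}} {a b} → n · a ≈ n · b → a ≈ b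
  ·-cancelˡ n@(ℕ.suc m) {a} {b} na≈nb = ≈-trans (≈-sym (inverse a)) (≈-trans (*-congˡ na≈nb) (inverse b))
    where
    inverse : ∀ a → 1/ n * (n · a) ≈ a
    inverse a = begin
      1/ n * (n · a)             ≈⟨ *-congˡ (×-congʳ n (*-identityˡ a)) ⟨
      1/ n * (n · (1# * a))      ≈⟨ *-congˡ (×-assoc-* n 1# a) ⟨
      1/ n * (n · 1# * a)        ≈⟨ *-assoc _ _ _ ⟨
      -- `1/ n` comes from the apartness of n · 1 and 0, as an inverse of their difference, so the
      -- subtraction of 0 has to be inserted.
      1/ n * (n · 1#) * a        ≈⟨ *-congʳ (*-congˡ (≈-trans (+-congˡ -0#≈0#) (+-identityʳ _))) ⟨
      1/ n * (n · 1# - 0#) * a   ≈⟨ *-congʳ (proj₁ (proj₂ (#⇒invertible (Equivalence.from #⇔<⊎> (inj₂ (0<1+n m)))))) ⟩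
      1# * a                     ≈⟨ *-identityˡ a ⟩
      a                          ∎
      where open SetoidReasoning setoid

-- The complex numbers as a Hermitian ring.

module ComplexField {c ℓ₁ ℓ₂} (R : RealField c ℓ₁ ℓ₂) where

  open Complex R
  private
    module ℝ where
      open RealField R public
      open OrderedField R public
      open CommutativeRing (HeytingCommutativeRing.commutativeRing heytingCommutativeRing) public
        using (ring; semiring)
      open ComponentIdentities (HeytingCommutativeRing.commutativeRing heytingCommutativeRing) public
      open import Algebra.Properties.Ring ring public using (-0#≈0#; -‿involutive; -‿+-comm)
      open import Algebra.Properties.Semiring.Sum semiring public using (sum; sum-cong-≋)

  isEquivalence : IsEquivalence _≈_
  isEquivalence = record
    { refl  = ℝ.refl , ℝ.refl
    ; sym   = λ (p , q) → ℝ.sym p , ℝ.sym q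
    ; trans = λ (p , q) (p′ , q′) → ℝ.trans p p′ , ℝ.trans q q′
    }

  commutativeRing : CommutativeRing c ℓ₁
  commutativeRing = record
    { isCommutativeRing = record
      { isRing = record
        { +-isAbelianGroup = record
          { isGroup = record
            { isMonoid = record
              { isSemigroup = record
                { isMagma = record
                  { isEquivalence = isEquivalence
                  ; ∙-cong        = λ (p , q) (p′ , q′) → ℝ.+-cong p p′ , ℝ.+-cong q q′
                  }
                ; assoc = λ z w v → ℝ.+-assoc _ _ _ , ℝ.+-assoc _ _ _
                }
              ; identity = (λ z → ℝ.+-identityˡ _ , ℝ.+-identityˡ _) , (λ z → ℝ.+-identityʳ _ , ℝ.+-identityʳ _)
              }
            ; inverse = (λ z → ℝ.-‿inverseˡ _ , ℝ.-‿inverseˡ _) , (λ z → ℝ.-‿inverseʳ _ , ℝ.-‿inverseʳ _)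
            ; ⁻¹-cong = λ (p , q) → ℝ.-‿cong p , ℝ.-‿cong q
            }
          ; comm = λ z w → ℝ.+-comm _ _ , ℝ.+-comm _ _
          }
        ; *-cong     = *-cong
        ; *-assoc    = λ (a +i b) (c +i d) (e +i f) → ℝ.*-assoc-re a b c d e f , ℝ.*-assoc-im a b c d e f
        ; *-identity = comm∧idˡ⇒id setoid *-comm λ (a +i b) → ℝ.*-identityˡ-re a b , ℝ.*-identityˡ-im a b
        ; distrib    = comm∧distrˡ⇒distr setoid (λ (p , q) (p′ , q′) → ℝ.+-cong p p′ , ℝ.+-cong q q′) *-comm
                         λ (a +i b) (c +i d) (e +i f) → ℝ.*-distribˡ-re a b c d e f , ℝ.*-distribˡ-im a b c d e f
        }
      ; *-comm = *-comm
      }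
    }
    where
    setoid : Setoid c ℓ₁
    setoid = record { isEquivalence = isEquivalence }

    *-cong : ∀ {z z′ w w′} → z ≈ z′ → w ≈ w′ → z * w ≈ z′ * w′
    *-cong (p , q) (p′ , q′) =
      ℝ.+-cong (ℝ.*-cong p p′) (ℝ.-‿cong (ℝ.*-cong q q′)) , ℝ.+-cong (ℝ.*-cong p q′) (ℝ.*-cong q p′)

    *-comm : ∀ z w → z * w ≈ w * z
    *-comm (a +i b) (c +i d) = ℝ.*-comm-re a b c d , ℝ.*-comm-im a b c d

  conj-isRingHomomorphism : IsRingHomomorphism rawRing rawRing conj
  conj-isRingHomomorphism = record
    { isSemiringHomomorphism = record
      { isNearSemiringHomomorphism = record
        { +-isMonoidHomomorphism = record
          { isMagmaHomomorphism = record
            { isRelHomomorphism = record { cong = λ (p , q) → p , ℝ.-‿cong q }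
            ; homo              = λ z w → ℝ.refl , ℝ.sym (ℝ.-‿+-comm _ _)
            }
          ; ε-homo = ℝ.refl , ℝ.-0#≈0#
          }
        ; *-homo = λ (a +i b) (c +i d) → ℝ.conj-*-re a b c d , ℝ.conj-*-im a b c d
        }
      ; 1#-homo = ℝ.refl , ℝ.-0#≈0#
      }
    ; -‿homo = λ z → ℝ.refl , ℝ.refl
    }

  conj-involutive : Involutive _≈_ conj
  conj-involutive z = ℝ.refl , ℝ.-‿involutive _

  unimodular⇒z*conj-z≈1 : ∀ {z} → ∣ z ∣² ℝ.≈ ℝ.1# → z * conj z ≈ 1ℂ
  unimodular⇒z*conj-z≈1 ∣z∣²≈1 = ℝ.trans (ℝ.z*conj-z-re _ _) ∣z∣²≈1 , ℝ.z*conj-z-im _ _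

  re-sum : ∀ {n} (v : Vector ℂ n) → re (sum v) ℝ.≈ ℝ.sum (re ∘ v)
  re-sum {ℕ.zero}  v = ℝ.refl
  re-sum {ℕ.suc n} v = ℝ.+-congˡ (re-sum (v ∘ suc))

  -- The real part of the hypothesis is a vanishing sum of the nonnegative reals ∣ v i ∣², so each
  -- of these is 0, and with it both squares that compose it.
  definite : ∀ {n} (v : Vector ℂ n) → sum (λ i → v i * conj (v i)) ≈ 0ℂ → ∀ i → v i ≈ 0ℂ
  definite {n} v (re≈0 , _) i =
    ℝ.a*a≈0⇒a≈0 (ℝ.a+b≈0⇒a≈0 (ℝ.0≤a*a _) (ℝ.0≤a*a _) ∣v∣²≈0) ,
    ℝ.a*a≈0⇒a≈0 (ℝ.a+b≈0⇒b≈0 (ℝ.0≤a*a _) (ℝ.0≤a*a _) ∣v∣²≈0)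
    where
    ∣v∣²≈0 : ∣ v i ∣² ℝ.≈ ℝ.0#
    ∣v∣²≈0 = ℝ.sum≈0⇒≈0 {n} {λ i → ∣ v i ∣²} (λ i → ℝ.+-nonneg (ℝ.0≤a*a _) (ℝ.0≤a*a _))
      (ℝ.trans (ℝ.sym (ℝ.trans (re-sum {n} _) (ℝ.sum-cong-≋ {n} λ i → ℝ.z*conj-z-re (re (v i)) (im (v i))))) re≈0) i

  re-· : ∀ n z → re (n · z) ℝ.≈ n ℝ.· re z
  re-· ℕ.zero    z = ℝ.refl
  re-· (ℕ.suc n) z = ℝ.+-congˡ (re-· n z)

  im-· : ∀ n z → im (n · z) ℝ.≈ n ℝ.· im z
  im-· ℕ.zero    z = ℝ.refl
  im-· (ℕ.suc n) z = ℝ.+-congˡ (im-· n z)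

  ·-cancelˡ : ∀ n .{{_ : NonZero n}} {z w} → n · z ≈ n · w → z ≈ w
  ·-cancelˡ n {z} {w} (p , q) =
    ℝ.·-cancelˡ n (ℝ.trans (ℝ.sym (re-· n z)) (ℝ.trans p (re-· n w))) ,
    ℝ.·-cancelˡ n (ℝ.trans (ℝ.sym (im-· n z)) (ℝ.trans q (im-· n w)))

  hermitianRing : HermitianRing c ℓ₁
  hermitianRing = record
    { commutativeRing         = commutativeRing
    ; conj                    = conj
    ; conj-isRingHomomorphism = conj-isRingHomomorphism
    ; conj-involutive         = conj-involutive
    ; definite                = definite
    ; ·-cancelˡ               = ·-cancelˡ
    }

-- Entries of the block matrix.

module BorderedEntries {c ℓ₁ ℓ₂} (R : RealField c ℓ₁ ℓ₂) where

  open Complex R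
  open ComplexField R
  open CommutativeRing commutativeRing using (*-identityʳ; reflexive; trans)

  module Entries (k n : ℕ) (x : ℂ) (S : Matrix k k) (A : Matrix (k ℕ.* n) (k ℕ.* n)) where

    bordered-S : ∀ l t → bordered k n x S A (l ↑ˡ k ℕ.* n) (t ↑ˡ k ℕ.* n) ≡ S l t
    bordered-S l t rewrite splitAt-↑ˡ k l (k ℕ.* n) | splitAt-↑ˡ k t (k ℕ.* n) = ≡.refl

    bordered-A : ∀ p q → bordered k n x S A (k ↑ʳ p) (k ↑ʳ q) ≡ A p q
    bordered-A p q rewrite splitAt-↑ʳ k (k ℕ.* n) p | splitAt-↑ʳ k (k ℕ.* n) q = ≡.refl

    -- F ⊗ jₙ has k * 1 rows, read as k through a cast. The cast row is the pair (l , 0), so the row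
    -- of F behind it is l.
    quotient-cast : ∀ (l : Fin k) → proj₁ (remQuot {k} 1 (cast (≡.sym (ℕ.*-identityʳ k)) l)) ≡ l
    quotient-cast l = ≡.trans (≡.cong (proj₁ ∘ remQuot {k} 1) cast≡combine) (≡.cong proj₁ (remQuot-combine l zero))
      where
      open ≡.≡-Reasoning
      cast≡combine : cast (≡.sym (ℕ.*-identityʳ k)) l ≡ combine {k} {1} l zero
      cast≡combine = toℕ-injective (begin
        toℕ (cast (≡.sym (ℕ.*-identityʳ k)) l)  ≡⟨ toℕ-cast _ l ⟩
        toℕ l                                   ≡⟨ ℕ.*-identityˡ (toℕ l) ⟨
        1 ℕ.* toℕ l                             ≡⟨ ℕ.+-identityʳ _ ⟨
        1 ℕ.* toℕ l ℕ.+ 0                       ≡⟨ toℕ-combine l (zero {0}) ⟨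
        toℕ (combine {k} {1} l zero)            ∎)

    bordered-F : ∀ l j u → bordered k n x S A (l ↑ˡ k ℕ.* n) (k ↑ʳ combine j u) ≈ fourier x k l j
    bordered-F l j u
      rewrite splitAt-↑ˡ k l (k ℕ.* n) | splitAt-↑ʳ k (k ℕ.* n) (combine j u)
      = trans (*-identityʳ _) (reflexive (≡.cong₂ (fourier x k) (quotient-cast l) (≡.cong proj₁ (remQuot-combine j u))))

    bordered-Fᴴ : ∀ i r t → bordered k n x S A (k ↑ʳ combine i r) (t ↑ˡ k ℕ.* n) ≈ conj (fourier x k t i)
    bordered-Fᴴ i r t
      rewrite splitAt-↑ˡ k t (k ℕ.* n) | splitAt-↑ʳ k (k ℕ.* n) (combine i r)
      = trans (*-identityʳ _) (reflexive (≡.cong₂ (fourier x k ᴴ) (≡.cong proj₁ (remQuot-combine i r)) (quotient-cast t)))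

theorem5p3 : ∀ {c ℓ₁ ℓ₂} (R : RealField c ℓ₁ ℓ₂) → let open Complex R in
    (exp : ℂ → ℂ) → IsExponential exp →
    (π : ℝ) → IsPi exp π →
    (k n : ℕ) .{{_ : NonZero k}} → 2 ℕ.≤ k → 1 ℕ.≤ n →
    let x = ζ exp π k in
    (s : Vector ℂ k) → BH k k (circ s) →
    (A : Matrix (k ℕ.* n) (k ℕ.* n)) (H : Matrix (k ℕ.+ k ℕ.* n) (k ℕ.+ k ℕ.* n)) →
    BH (k ℕ.+ k ℕ.* n) k H →
    H ≋ bordered k n x (circ s) A →
    ((i j : Fin k) → i ≢ j →
    RowSums (block k n A i j) 0ℂ × ColumnSums (block k n A i j) 0ℂ)
    ×
    ((m : Fin k) →
    RowSums (block k n A m m) (- conj (eigenvalue x s m)) × ColumnSums (block k n A m m) (- conj (eigenvalue x s m)))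
-- Matching on k ≥ 2 makes `1F` an index of F, where x itself is found; matching on n ≥ 1 makes
-- `zero` a position in every block.
theorem5p3 R exp _ π _ k@(suc (suc _)) n@(suc _) (s≤s (s≤s _)) (s≤s _) s S-BH A H H-BH H≋ =
  (λ i j i≢j → (λ r → trans (rowSums i r j) (off-diagonal i≢j)) ,
               -- A column of the block (i , j) lies in block column j, so the scalar matrix is
               -- evaluated at (j , i).
               (λ r → trans (columnSums j r i) (off-diagonal (i≢j ∘ ≡.sym)))) ,
  (λ m → (λ r → trans (rowSums m r m) (diagonal m)) ,
         (λ r → trans (columnSums m r m) (diagonal m)))
  where
  open Complex R
  open ComplexField R
  open BorderedEntries R
  open HermitianRing hermitianRing using (trans; sym; reflexive; -‿cong; *-identityʳ; ring; semiring)
  open import Algebra.Properties.Ring ring using (-0#≈0#)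
  open import Algebra.Properties.Semiring.Exp semiring using (^-congˡ)
  open HermitianRingProperties hermitianRing
    using (module BorderedHadamard; IsBorderedHadamard; scalar-≡; scalar-≢)
  open IsRingHomomorphism conj-isRingHomomorphism using (⟦⟧-cong; 0#-homo)
  module S = IsHadamard (BH.isHadamard S-BH)
  module H = IsHadamard (BH.isHadamard H-BH)

  x : ℂ
  x = ζ exp π k

  open Entries k n x (circ s) A

  -- The entry of H in question has both Fourier indices equal to 1. There F holds x ^ (1 * 1),
  -- which unfolds to x * 1.
  x^k≈1 : x ^ k ≈ 1ℂ
  x^k≈1 = trans (^-congˡ k (sym (trans (H≋ p q) (trans (bordered-F 1F 1F zero) (*-identityʳ x)))))
                (BH.rootOfUnity H-BH p q)
    where
    p q : Fin (k ℕ.+ k ℕ.* n)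
    p = 1F ↑ˡ k ℕ.* n
    q = k ↑ʳ combine {k} {n} 1F zero

  H-isBordered : IsBorderedHadamard s x (λ i r j u → A (combine i r) (combine j u)) H
  H-isBordered = record
    { x^k≈1        = x^k≈1
    ; S-orthogonal = S.orthogonal
    ; H-unimodular = λ p q → unimodular⇒z*conj-z≈1 (H.unimodular p q)
    ; H-orthogonal = H.orthogonal
    ; H-S          = λ l t → trans (H≋ _ _) (reflexive (bordered-S l t))
    ; H-F          = λ l j u → trans (H≋ _ _) (bordered-F l j u)
    ; H-Fᴴ         = λ i r t → trans (H≋ _ _) (bordered-Fᴴ i r t)
    ; H-A          = λ i r j u → trans (H≋ _ _) (reflexive (bordered-A (combine i r) (combine j u)))
    }

  open BorderedHadamard zero H-isBordered using (rowSums; columnSums)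

  off-diagonal : ∀ {a} {i j : Fin k} → i ≢ j → - conj (scalar k a i j) ≈ 0ℂ
  off-diagonal i≢j = trans (-‿cong (trans (⟦⟧-cong (scalar-≢ i≢j)) 0#-homo)) -0#≈0#

  diagonal : ∀ m → - conj (scalar k (eigenvalue x s m) m m) ≈ - conj (eigenvalue x s m)
  diagonal m = -‿cong (⟦⟧-cong (scalar-≡ {i = m} ≡.refl))
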